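{- Let $G$ be an interval graph with a fixed interval representation $v\mapsto I(v)=[L(v),R(v)]$. Then the left-to-right orientation $\to$ of the compatibility graph $H_G$ determined by this representation is transitive: for all vertices $e,f,g$ of $H_G$, if $e\to f$ and $f\to g$, then $eg$ is an edge of $H_G$ and it is oriented as $e\to g$.
   Context: All graphs are finite, simple and undirected. An interval representation of $G$ assigns to each vertex $v$ a closed real interval $I(v)=[L(v),R(v)]$ so that two distinct vertices are adjacent precisely when their intervals intersect; $G$ is an interval graph if it has one. The compatibility graph $H_G$ has as vertices the ordered edges $(c,\ell)$ with $c\ell\in E(G)$ (each edge gives two ordered edges). Two distinct ordered edges $(c,\ell)$ and $(d,r)$ are adjacent in $H_G$ if and only if they are compatible, i.e. either (same centre) $c=d$, $\ell\ne r$ and $\ell r\notin E(G)$; or (different centres) $c\neq d$, the four vertices $c,\ell,d,r$ are distinct, and $cd,cr,\ell d,\ell r\notin E(G)$. For a vertex $e=(c,\ell)$ of $H_G$ put $\lambda(e)=\min\{L(c),L(\ell)\}$ and $\rho(e)=\max\{R(c),R(\ell)\}$, so that $I(c)\cup I(\ell)=[\lambda(e),\rho(e)]$. Each edge of $H_G$ is given exactly one direction as follows. For adjacent $e=(c,\ell)$ and $f=(c,r)$ with the same centre: $e\to f$ if $R(\ell)<L(r)$; otherwise $R(r)<L(\ell)$ and $f\to e$. For adjacent $e=(c,\ell)$ and $f=(d,r)$ with $c\neq d$: $e\to f$ if $\rho(e)<\lambda(f)$; otherwise $\rho(f)<\lambda(e)$ and $f\to e$. -}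

module Defs where

open import Data.Fin.Base using (Fin)
open import Data.List.Base using (_∷_; [])
open import Data.List.Relation.Unary.Unique.Propositional using (Unique)
open import Data.Nat.Base using (ℕ)
open import Data.Product.Base using (_×_; _,_; proj₁; proj₂; ∃-syntax)
open import Data.Rational.Base as ℚ using (ℚ)
import Data.Rational.Properties as ℚ
open import Data.Sum.Base using (_⊎_; inj₁; inj₂)
open import Function.Bundles using (_⇔_; mk⇔; Equivalence)
open import Level using (0ℓ)
open import Relation.Binary.Core using (Rel)
open import Relation.Binary.Definitions using (Decidable; Irreflexive; Symmetric)
open import Relation.Binary.PropositionalEquality.Core using (_≡_; _≢_; refl; subst; sym)
open import Relation.Nullary.Negation.Core using (¬_)
open import Relation.Unary using (Pred)

-- Real numbers as two-sided Dedekind cuts.  Two cuts describe the same real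
-- when each is ≤ the other; this need not make them propositionally equal.

record ℝ : Set₁ where
  field
    Lower Upper     : Pred ℚ 0ℓ
    lower-inhabited : ∃[ q ] Lower q
    upper-inhabited : ∃[ q ] Upper q
    lower-rounded   : ∀ q → Lower q ⇔ (∃[ r ] q ℚ.< r × Lower r)
    upper-rounded   : ∀ q → Upper q ⇔ (∃[ r ] r ℚ.< q × Upper r)
    disjoint        : ∀ q → ¬ (Lower q × Upper q)
    located         : ∀ q r → q ℚ.< r → Lower q ⊎ Upper r

  lower-closed : ∀ {q r} → q ℚ.≤ r → Lower r → Lower q
  lower-closed {q} {r} q≤r r∈L with Equivalence.to (lower-rounded r) r∈L
  ... | s , r<s , s∈L =
    Equivalence.from (lower-rounded q) (s , ℚ.≤-<-trans q≤r r<s , s∈L)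

  upper-closed : ∀ {q r} → q ℚ.≤ r → Upper q → Upper r
  upper-closed {q} {r} q≤r q∈U with Equivalence.to (upper-rounded q) q∈U
  ... | s , s<q , s∈U =
    Equivalence.from (upper-rounded r) (s , ℚ.<-≤-trans s<q q≤r , s∈U)

open ℝ

infix 4 _<_ _≤_

_<_ : Rel ℝ 0ℓ
x < y = ∃[ q ] Upper x q × Lower y q

_≤_ : Rel ℝ 0ℓ
x ≤ y = ¬ (y < x)

private
  ⊔-< : ∀ {p q r} → p ℚ.< r → q ℚ.< r → p ℚ.⊔ q ℚ.< r
  ⊔-< {p} {q} {r} p<r q<r with ℚ.⊔-sel p q
  ... | inj₁ eq = subst (ℚ._< r) (sym eq) p<r
  ... | inj₂ eq = subst (ℚ._< r) (sym eq) q<r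

  <-⊓ : ∀ {p q r} → r ℚ.< p → r ℚ.< q → r ℚ.< p ℚ.⊓ q
  <-⊓ {p} {q} {r} r<p r<q with ℚ.⊓-sel p q
  ... | inj₁ eq = subst (r ℚ.<_) (sym eq) r<p
  ... | inj₂ eq = subst (r ℚ.<_) (sym eq) r<q

max : ℝ → ℝ → ℝ
max x y = record
  { Lower           = λ q → Lower x q ⊎ Lower y q
  ; Upper           = λ q → Upper x q × Upper y q
  ; lower-inhabited = proj₁ (lower-inhabited x) , inj₁ (proj₂ (lower-inhabited x))
  ; upper-inhabited = let (a , a∈) = upper-inhabited x ; (b , b∈) = upper-inhabited y in
      a ℚ.⊔ b , upper-closed x (ℚ.p≤p⊔q a b) a∈ , upper-closed y (ℚ.p≤q⊔p a b) b∈
  ; lower-rounded   = λ q → mk⇔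
      (λ { (inj₁ l) → let (r , q<r , r∈) = Equivalence.to (lower-rounded x q) l in r , q<r , inj₁ r∈
         ; (inj₂ l) → let (r , q<r , r∈) = Equivalence.to (lower-rounded y q) l in r , q<r , inj₂ r∈ })
      (λ { (r , q<r , inj₁ l) → inj₁ (lower-closed x (ℚ.<⇒≤ q<r) l)
         ; (r , q<r , inj₂ l) → inj₂ (lower-closed y (ℚ.<⇒≤ q<r) l) })
  ; upper-rounded   = λ q → mk⇔
      (λ (u , v) → let (a , a<q , a∈) = Equivalence.to (upper-rounded x q) u
                       (b , b<q , b∈) = Equivalence.to (upper-rounded y q) v in
        a ℚ.⊔ b , ⊔-< a<q b<q ,
        upper-closed x (ℚ.p≤p⊔q a b) a∈ , upper-closed y (ℚ.p≤q⊔p a b) b∈)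
      (λ (r , r<q , u , v) → upper-closed x (ℚ.<⇒≤ r<q) u , upper-closed y (ℚ.<⇒≤ r<q) v)
  ; disjoint        = λ { q (inj₁ l , u , _) → disjoint x q (l , u)
                        ; q (inj₂ l , _ , v) → disjoint y q (l , v) }
  ; located         = loc
  }
  where
  loc : ∀ q r → q ℚ.< r → (Lower x q ⊎ Lower y q) ⊎ (Upper x r × Upper y r)
  loc q r q<r with located x q r q<r | located y q r q<r
  ... | inj₁ l | _      = inj₁ (inj₁ l)
  ... | inj₂ _ | inj₁ l = inj₁ (inj₂ l)
  ... | inj₂ u | inj₂ v = inj₂ (u , v)

min : ℝ → ℝ → ℝ
min x y = record
  { Lower           = λ q → Lower x q × Lower y q
  ; Upper           = λ q → Upper x q ⊎ Upper y q
  ; lower-inhabited = let (a , a∈) = lower-inhabited x ; (b , b∈) = lower-inhabited y in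
      a ℚ.⊓ b , lower-closed x (ℚ.p⊓q≤p a b) a∈ , lower-closed y (ℚ.p⊓q≤q a b) b∈
  ; upper-inhabited = proj₁ (upper-inhabited x) , inj₁ (proj₂ (upper-inhabited x))
  ; lower-rounded   = λ q → mk⇔
      (λ (l , m) → let (a , q<a , a∈) = Equivalence.to (lower-rounded x q) l
                       (b , q<b , b∈) = Equivalence.to (lower-rounded y q) m in
        a ℚ.⊓ b , <-⊓ q<a q<b ,
        lower-closed x (ℚ.p⊓q≤p a b) a∈ , lower-closed y (ℚ.p⊓q≤q a b) b∈)
      (λ (r , q<r , l , m) → lower-closed x (ℚ.<⇒≤ q<r) l , lower-closed y (ℚ.<⇒≤ q<r) m)
  ; upper-rounded   = λ q → mk⇔
      (λ { (inj₁ u) → let (r , r<q , r∈) = Equivalence.to (upper-rounded x q) u in r , r<q , inj₁ r∈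
         ; (inj₂ u) → let (r , r<q , r∈) = Equivalence.to (upper-rounded y q) u in r , r<q , inj₂ r∈ })
      (λ { (r , r<q , inj₁ u) → inj₁ (upper-closed x (ℚ.<⇒≤ r<q) u)
         ; (r , r<q , inj₂ u) → inj₂ (upper-closed y (ℚ.<⇒≤ r<q) u) })
  ; disjoint        = λ { q ((l , _) , inj₁ u) → disjoint x q (l , u)
                        ; q ((_ , m) , inj₂ u) → disjoint y q (m , u) }
  ; located         = loc
  }
  where
  loc : ∀ q r → q ℚ.< r → (Lower x q × Lower y q) ⊎ (Upper x r ⊎ Upper y r)
  loc q r q<r with located x q r q<r | located y q r q<r
  ... | inj₂ u | _      = inj₂ (inj₁ u)
  ... | inj₁ _ | inj₂ u = inj₂ (inj₂ u)
  ... | inj₁ l | inj₁ m = inj₁ (l , m)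

record ClosedInterval : Set₁ where
  field
    left right : ℝ
    left≤right : left ≤ right

open ClosedInterval

infix 4 _∈ᴵ_

_∈ᴵ_ : ℝ → ClosedInterval → Set
x ∈ᴵ I = left I ≤ x × x ≤ right I

Intersect : Rel ClosedInterval _
Intersect I J = ∃[ x ] x ∈ᴵ I × x ∈ᴵ J

record Graph : Set₁ where
  field
    order  : ℕ
    Adj    : Rel (Fin order) 0ℓ
    adj?   : Decidable Adj
    symm   : Symmetric Adj
    irrefl : Irreflexive _≡_ Adj

  Vertex : Set
  Vertex = Fin order

record IntervalRepresentation (G : Graph) : Set₁ where
  open Graph G
  field
    I              : Vertex → ClosedInterval
    adj⇔intersect : ∀ u v → u ≢ v → Adj u v ⇔ Intersect (I u) (I v)

  L R : Vertex → ℝ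
  L v = left (I v)
  R v = right (I v)

module CompatibilityGraph (G : Graph) where
  open Graph G

  -- The adjacency proof is irrelevant, so that an ordered edge is determined
  -- by the pair (centre , leaf).
  record OrderedEdge : Set where
    constructor orderedEdge
    field
      centre leaf : Vertex
      .isEdge     : Adj centre leaf

  open OrderedEdge public

  infix 4 _~_

  -- Each constructor forces the two ordered edges to be distinct.
  data _~_ (e f : OrderedEdge) : Set where
    same-centre :
      centre e ≡ centre f →
      leaf e ≢ leaf f →
      ¬ Adj (leaf e) (leaf f) →
      e ~ f
    different-centres :
      centre e ≢ centre f →
      Unique (centre e ∷ leaf e ∷ centre f ∷ leaf f ∷ []) →
      ¬ Adj (centre e) (centre f) →
      ¬ Adj (centre e) (leaf f) →
      ¬ Adj (leaf e) (centre f) →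
      ¬ Adj (leaf e) (leaf f) →
      e ~ f

module Orientation {G : Graph} (rep : IntervalRepresentation G) where
  open CompatibilityGraph G public
  open IntervalRepresentation rep

  λᵉ ρᵉ : OrderedEdge → ℝ
  λᵉ e = min (L (centre e)) (L (leaf e))
  ρᵉ e = max (R (centre e)) (R (leaf e))

  infix 4 _⟶_

  -- When e ~ f, at most one of the two inequalities (the one stated and the one
  -- with e and f exchanged) holds, and they cannot both fail: classically
  -- exactly one of e ⟶ f and f ⟶ e holds.  Neither direction is defined as
  -- the negation of the other, since < on ℝ is not decidable.
  data _⟶_ (e f : OrderedEdge) : Set where
    same-centre :
      e ~ f → centre e ≡ centre f → R (leaf e) < L (leaf f) → e ⟶ f
    different-centres :
      e ~ f → centre e ≢ centre f → ρᵉ e < λᵉ f → e ⟶ f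

{-# OPTIONS --safe #-}
module Submission where

open import Defs
open import Data.List.Relation.Unary.All using ([]; _∷_)
open import Data.List.Relation.Unary.AllPairs using ([]; _∷_)
open import Data.Product.Base using (_×_; _,_)
import Data.Rational.Properties as ℚ
open import Data.Sum.Base using (inj₁; inj₂)
open import Function.Bundles using (Equivalence)
open import Relation.Binary.PropositionalEquality.Core using (_≡_; _≢_; refl; sym; subst; trans)
open import Relation.Nullary.Decidable.Core using (recompute)
open import Relation.Nullary.Negation.Core using (¬_; contradiction)

-- An interval that ends before another begins is distinct from it and disjoint
-- from it, so the inequality defining e ⟶ g already forces e ~ g.  It follows
-- from those of e ⟶ f and f ⟶ g because some vertex of f has its whole interval
-- between the two parts of e and g being compared; when e or g shares its centre
-- with f, the centre is separated from the remaining edge by hypothesis.  If all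
-- three centres agree, only the leaves are compared.

module _ where
  open ℝ

  -- Since `≤` is a negated `<`, a rational between `x` and `z` has to be found. Rounding gives `r`
  -- with `q < r` still below `y`; locating `z` against this pair puts `q` below `z`, as `r` above
  -- `z` would yield `z < y`.
  <-≤-trans : ∀ x y z → x < y → y ≤ z → x < z
  <-≤-trans x y z (q , q∈Ux , q∈Ly) y≤z
    with Equivalence.to (lower-rounded y q) q∈Ly
  ... | r , q<r , r∈Ly with located z q r q<r
  ...   | inj₁ q∈Lz = q , q∈Ux , q∈Lz
  ...   | inj₂ r∈Uz = contradiction (r , r∈Uz , r∈Ly) y≤z

  <-trans : ∀ x y z → x < y → y < z → x < z
  <-trans x y z (q , q∈Ux , q∈Ly) (r , r∈Uy , r∈Lz) with ℚ.≤-total q r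
  ... | inj₁ q≤r = q , q∈Ux , lower-closed z q≤r r∈Lz
  ... | inj₂ r≤q = contradiction (q∈Ly , upper-closed y r≤q r∈Uy) (disjoint y q)

  -- The larger of the two rational witnesses is above both `x` and `y` and still below `z`.
  max-< : ∀ x y z → x < z → y < z → max x y < z
  max-< x y z (q , q∈Ux , q∈Lz) (r , r∈Uy , r∈Lz) with ℚ.≤-total q r
  ... | inj₁ q≤r = r , (upper-closed x q≤r q∈Ux , r∈Uy) , r∈Lz
  ... | inj₂ r≤q = q , (q∈Ux , upper-closed y r≤q r∈Uy) , q∈Lz

  <-min : ∀ x y z → z < x → z < y → z < min x y
  <-min x y z (q , q∈Uz , q∈Lx) (r , r∈Uz , r∈Ly) with ℚ.≤-total q r
  ... | inj₁ q≤r = q , q∈Uz , (q∈Lx , lower-closed y q≤r r∈Ly)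
  ... | inj₂ r≤q = r , r∈Uz , (lower-closed x r≤q q∈Lx , r∈Ly)

module _ {G : Graph} (rep : IntervalRepresentation G) where
  open Graph G
  open IntervalRepresentation rep
  open ClosedInterval using (left≤right)
  open Orientation rep

  Adj⇒≢ : ∀ {u v} → Adj u v → u ≢ v
  Adj⇒≢ uv u≡v = irrefl u≡v uv

  R<L⇒≢ : ∀ u v → R u < L v → u ≢ v
  R<L⇒≢ u _ Ru<Lv refl = left≤right (I u) Ru<Lv

  -- A common point `x` would satisfy `L v ≤ x ≤ R u`.
  R<L⇒¬Adj : ∀ u v → R u < L v → ¬ Adj u v
  R<L⇒¬Adj u v Ru<Lv uv
    with Equivalence.to (adj⇔intersect u v (Adj⇒≢ uv)) uv
  ... | x , (_ , x≤Ru) , (Lv≤x , _) = x≤Ru (<-≤-trans (R u) (L v) x Ru<Lv Lv≤x)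

  -- The gap is bridged by `L v ≤ R v`. Each case of transitivity applies this with `v` a vertex of
  -- the middle edge.
  <L-R<-trans : ∀ x v y → x < L v → R v < y → x < y
  <L-R<-trans x v y x<Lv Rv<y =
    <-trans x (R v) y (<-≤-trans x (L v) (R v) x<Lv (left≤right (I v))) Rv<y

  centre≢leaf : ∀ e → centre e ≢ leaf e
  -- The irrelevant edge proof becomes usable because adjacency is decidable.
  centre≢leaf (orderedEdge c ℓ cℓ) = Adj⇒≢ (recompute (adj? c ℓ) cℓ)

  leaf-separated⇒⟶ : ∀ e f → centre e ≡ centre f → R (leaf e) < L (leaf f) →
                     (e ~ f) × (e ⟶ f)
  leaf-separated⇒⟶ e f c≡d Rℓ<Lr = e~f , same-centre e~f c≡d Rℓ<Lr
    where
    e~f : e ~ f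
    e~f = same-centre c≡d (R<L⇒≢ (leaf e) (leaf f) Rℓ<Lr)
                          (R<L⇒¬Adj (leaf e) (leaf f) Rℓ<Lr)

  -- The upper cut of a `max` and the lower cut of a `min` are conjunctions, so one rational `q`
  -- witnesses all four endpoint inequalities.
  separated⇒⟶ : ∀ e f → ρᵉ e < λᵉ f → (e ~ f) × (e ⟶ f)
  separated⇒⟶ e f ρe<λf@(q , (q∈URc , q∈URℓ) , (q∈LLd , q∈LLr)) =
    e~f , different-centres e~f c≢d ρe<λf
    where
    c ℓ d r : Vertex
    c = centre e
    ℓ = leaf e
    d = centre f
    r = leaf f

    Rc<Ld : R c < L d
    Rc<Ld = q , q∈URc , q∈LLd

    Rc<Lr : R c < L r
    Rc<Lr = q , q∈URc , q∈LLr

    Rℓ<Ld : R ℓ < L d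
    Rℓ<Ld = q , q∈URℓ , q∈LLd

    Rℓ<Lr : R ℓ < L r
    Rℓ<Lr = q , q∈URℓ , q∈LLr

    c≢d : c ≢ d
    c≢d = R<L⇒≢ c d Rc<Ld

    e~f : e ~ f
    e~f = different-centres
      c≢d
      ((centre≢leaf e ∷ c≢d ∷ R<L⇒≢ c r Rc<Lr ∷ []) ∷
       (R<L⇒≢ ℓ d Rℓ<Ld ∷ R<L⇒≢ ℓ r Rℓ<Lr ∷ []) ∷
       (centre≢leaf f ∷ []) ∷ [] ∷ [])
      (R<L⇒¬Adj c d Rc<Ld) (R<L⇒¬Adj c r Rc<Lr)
      (R<L⇒¬Adj ℓ d Rℓ<Ld) (R<L⇒¬Adj ℓ r Rℓ<Lr)

  ⟶-trans : ∀ e f g → e ⟶ f → f ⟶ g → (e ~ g) × (e ⟶ g)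
  ⟶-trans e f g (same-centre _ c≡d Rℓ<Lr) (same-centre _ d≡b Rr<Ls) =
    leaf-separated⇒⟶ e g (trans c≡d d≡b)
      (<L-R<-trans (R (leaf e)) (leaf f) (L (leaf g)) Rℓ<Lr Rr<Ls)
  ⟶-trans e f g (same-centre _ c≡d Rℓ<Lr)
                (different-centres _ _ (q , (q∈URd , q∈URr) , q∈Lλg)) =
    -- The shared centre inherits its bound from `f`; the leaf of `e` gets its bound across the leaf
    -- of `f`.
    separated⇒⟶ e g (max-< (R (centre e)) (R (leaf e)) (λᵉ g)
      (subst (λ v → R v < λᵉ g) (sym c≡d) (q , q∈URd , q∈Lλg))
      (<L-R<-trans (R (leaf e)) (leaf f) (λᵉ g) Rℓ<Lr (q , q∈URr , q∈Lλg)))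
  ⟶-trans e f g (different-centres _ _ (q , q∈Uρe , (q∈LLd , q∈LLr)))
                (same-centre _ d≡b Rr<Ls) =
    separated⇒⟶ e g (<-min (L (centre g)) (L (leaf g)) (ρᵉ e)
      (subst (λ v → ρᵉ e < L v) d≡b (q , q∈Uρe , q∈LLd))
      (<L-R<-trans (ρᵉ e) (leaf f) (L (leaf g)) (q , q∈Uρe , q∈LLr) Rr<Ls))
  ⟶-trans e f g (different-centres _ _ (q , q∈Uρe , (q∈LLd , _)))
                (different-centres _ _ (r , (r∈URd , _) , r∈Lλg)) =
    -- Either vertex of `f` would serve as the bridge.
    separated⇒⟶ e g (<L-R<-trans (ρᵉ e) (centre f) (λᵉ g)
      (q , q∈Uρe , q∈LLd) (r , r∈URd , r∈Lλg))

lemma7 : (G : Graph) (rep : IntervalRepresentation G) →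
    let open Orientation rep in
    (e f g : OrderedEdge) → e ⟶ f → f ⟶ g → (e ~ g) × (e ⟶ g)
lemma7 G rep = ⟶-trans rep
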